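{- Let $a$ be an integral closed 2-frieze of width $m$, let $1\le k\le m$ and $c\in\mathbb{Z}$, and put $$x=a(k,c),\quad y=a(k,c+1),\quad u=a(k+1,c),\quad v=a(k+1,c+1)$$ (so $x,y$ are adjacent entries of a row and $u$, $v$ are the entries directly below $x$, $y$ respectively). Cutting the two columns $c,c+1$ directly below the pair $x,y$ and placing a pair $1\;1$ under $x,y$ gives an integral closed 2-frieze of width $k$, that is, there is an integral closed 2-frieze $w$ of width $k$ with $w(r,\epsilon)=a(r,c+\epsilon)$ for all $0\le r\le k$ and $\epsilon\in\{0,1\}$, if and only if $$u\equiv 1 \bmod y\qquad\text{and}\qquad v\equiv 1 \bmod x .$$
   Context: A closed 2-frieze of width $m$ is an array $a(r,c)$, with rows $r\in\{0,1,\dots,m+1\}$ (numbered from top to bottom) and columns $c\in\mathbb{Z}$ (numbered from left to right), whose top and bottom rows consist of 1s, i.e. $a(0,c)=a(m+1,c)=1$ for all $c\in\mathbb{Z}$, and which satisfies the local rule $$a(r,c)=a(r,c-1)\,a(r,c+1)-a(r-1,c)\,a(r+1,c)\qquad (1\le r\le m,\ c\in\mathbb{Z}).$$ A closed 2-frieze is integral if all its entries are positive integers. -}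

module Defs where

open import Data.Integer using (ℤ; 0ℤ; 1ℤ; _+_; _-_; _*_; _<_)
open import Data.Integer.Divisibility.Signed using (_∣_)
open import Data.Nat as ℕ using (ℕ; suc)
open import Relation.Binary.PropositionalEquality using (_≡_)

-- The entry in row r and column c is a r c.  An array of width m has the rows
-- 0, …, m + 1; the values at larger row indices are irrelevant, and every
-- condition below is restricted to the actual rows.
Array : Set
Array = ℕ → ℤ → ℤ

record IsClosed2Frieze (m : ℕ) (a : Array) : Set where
  field
    top    : ∀ c → a 0 c ≡ 1ℤ
    bottom : ∀ c → a (suc m) c ≡ 1ℤ
    -- The rule for row r is stated with r = suc p, so 1 ≤ r ≤ m becomes p < m.
    local  : ∀ p → p ℕ.< m → ∀ c →
             a (suc p) c
               ≡ a (suc p) (c - 1ℤ) * a (suc p) (c + 1ℤ) - a p c * a (suc (suc p)) c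

record IsIntegralClosed2Frieze (m : ℕ) (a : Array) : Set where
  field
    isClosed2Frieze : IsClosed2Frieze m a
    positive        : ∀ r → r ℕ.≤ suc m → ∀ c → 0ℤ < a r c

infix 4 _≡_mod_

_≡_mod_ : ℤ → ℤ → ℤ → Set
i ≡ j mod n = n ∣ i - j

{-# OPTIONS --safe #-}
module Submission where

-- Put W_n alternately equal to the vectors V_i of an SL₃-polygon and to the
-- cross products V_i × V_{i+1}.  Then W_n × W_{n+2} = W_{n+1}, and by the
-- Binet–Cauchy identity the products W_{c-r-1} · W_{c+r+2} satisfy the local rule
-- for any such sequence of vectors; any stretch of an integral frieze arises in this
-- way from vectors in ℤ³.  Cutting below x, y amounts to closing up the stretch
-- P, P × Q, Q, …, R, R × S, S of W, where x = (P × Q) · R, y = Q · (R × S),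
-- u = P · (R × S) and v = (P × Q) · S.  If u - 1 = q y and v - 1 = q′ x, then
-- P′ = P - q Q and S′ = S - q′ R make the periodic continuation with one more term
-- S′ × P′ satisfy the cross product rule, and positivity spreads from two columns.
-- Conversely, if w exists, the local rule carries the difference u - 1 of a and w
-- in row k + 1 along a diagonal up to row 1, where the difference is an integer d
-- with u - 1 = y d; likewise for v.

open import Defs
open import Algebra.Bundles using (AbelianGroup)
open import Data.Fin using (Fin; toℕ; zero; suc)
open import Data.Integer as ℤ using (ℤ; +_; -[1+_]; 0ℤ; 1ℤ; -1ℤ; _+_; _-_; -_; _*_; _<_; +<+; ∣_∣; _%ℕ_; _/ℕ_)
open import Data.Integer.DivMod using (n%ℕd<d; a≡a%ℕn+[a/ℕn]*n)
open import Data.Integer.Divisibility.Signed using (_∣_; divides)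
open import Data.Integer.Properties
open import Data.Integer.Tactic.RingSolver using (solve-∀)
open import Data.Nat as ℕ using (ℕ; zero; suc; z≤n; s≤s)
import Data.Nat.Divisibility as ℕ
import Data.Nat.Properties as ℕ
import Data.Nat.Tactic.RingSolver as ℕ
open import Data.Product using (∃; _×_; _,_; proj₁; proj₂)
open import Data.Sum using (inj₁; inj₂)
open import Function.Bundles using (_⇔_; mk⇔)
open import Relation.Binary.PropositionalEquality
open import Relation.Nullary using (contradiction)

open import Algebra.Properties.Group (AbelianGroup.group +-0-abelianGroup) using () renaming (∙-cancelˡ to +-cancelˡ)
open ≡-Reasoning

-- Dot and cross products in ℤ³

record ℤ³ : Set where
  constructor ⟨_,_,_⟩
  field x y z : ℤ

⟨⟩-cong : ∀ {a b c d e f} → a ≡ d → b ≡ e → c ≡ f → ⟨ a , b , c ⟩ ≡ ⟨ d , e , f ⟩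
⟨⟩-cong refl refl refl = refl

infixl 9 _⨯_
infix 8 _∙_
infixl 9 _⊕[_]_

-- Opaque, because otherwise conversion checking multiplies out integer coordinates.
opaque

  _⨯_ : ℤ³ → ℤ³ → ℤ³
  ⟨ a , b , c ⟩ ⨯ ⟨ d , e , f ⟩ = ⟨ b * f - c * e , c * d - a * f , a * e - b * d ⟩

  _∙_ : ℤ³ → ℤ³ → ℤ
  ⟨ a , b , c ⟩ ∙ ⟨ d , e , f ⟩ = a * d + b * e + c * f

  _⊕[_]_ : ℤ³ → ℤ → ℤ³ → ℤ³
  ⟨ a , b , c ⟩ ⊕[ q ] ⟨ d , e , f ⟩ = ⟨ a + q * d , b + q * e , c + q * f ⟩

opaque
  unfolding _⨯_ _∙_ _⊕[_]_

  -- When `B` comes two steps after `A` and `D` two steps after `C` in a sequence with the cross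
  -- product rule, the cross products are the terms in between, and this becomes the local rule.
  binet-cauchy : ∀ A B C D → (A ∙ C) * (B ∙ D) ≡ (A ⨯ B) ∙ (C ⨯ D) + (B ∙ C) * (A ∙ D)
  binet-cauchy ⟨ a , b , c ⟩ ⟨ d , e , f ⟩ ⟨ g , h , i ⟩ ⟨ j , k , l ⟩ = lemma a b c d e f g h i j k l
    where
    lemma : ∀ a b c d e f g h i j k l →
      (a * g + b * h + c * i) * (d * j + e * k + f * l)
      ≡ (b * f - c * e) * (h * l - i * k) + (c * d - a * f) * (i * j - g * l) + (a * e - b * d) * (g * k - h * j)
        + (d * g + e * h + f * i) * (a * j + b * k + c * l)
    lemma = solve-∀

  ∙-rotate : ∀ A B C → A ∙ (B ⨯ C) ≡ C ∙ (A ⨯ B)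
  ∙-rotate ⟨ a , b , c ⟩ ⟨ d , e , f ⟩ ⟨ g , h , i ⟩ = lemma a b c d e f g h i
    where
    lemma : ∀ a b c d e f g h i →
      a * (e * i - f * h) + b * (f * g - d * i) + c * (d * h - e * g)
      ≡ g * (b * f - c * e) + h * (c * d - a * f) + i * (a * e - b * d)
    lemma = solve-∀

  -- Without the hypothesis the result is `B` times the determinant of `A`, `B`, `C`; the
  -- coordinates are checked in that form.
  ⨯-⨯ : ∀ A B C → A ∙ (B ⨯ C) ≡ 1ℤ → (A ⨯ B) ⨯ (B ⨯ C) ≡ B
  ⨯-⨯ ⟨ a , b , c ⟩ ⟨ d , e , f ⟩ ⟨ g , h , i ⟩ eq = ⟨⟩-cong
      (trans (lemma₁ a b c d e f g h i) (scale d))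
      (trans (lemma₂ a b c d e f g h i) (scale e))
      (trans (lemma₃ a b c d e f g h i) (scale f))
    where
    scale : ∀ n → (a * (e * i - f * h) + b * (f * g - d * i) + c * (d * h - e * g)) * n ≡ n
    scale n = trans (cong (_* n) eq) (*-identityˡ n)
    lemma₁ : ∀ a b c d e f g h i →
      (c * d - a * f) * (d * h - e * g) - (a * e - b * d) * (f * g - d * i)
      ≡ (a * (e * i - f * h) + b * (f * g - d * i) + c * (d * h - e * g)) * d
    lemma₁ = solve-∀
    lemma₂ : ∀ a b c d e f g h i →
      (a * e - b * d) * (e * i - f * h) - (b * f - c * e) * (d * h - e * g)
      ≡ (a * (e * i - f * h) + b * (f * g - d * i) + c * (d * h - e * g)) * e
    lemma₂ = solve-∀
    lemma₃ : ∀ a b c d e f g h i →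
      (b * f - c * e) * (f * g - d * i) - (c * d - a * f) * (e * i - f * h)
      ≡ (a * (e * i - f * h) + b * (f * g - d * i) + c * (d * h - e * g)) * f
    lemma₃ = solve-∀

  ∙-comm : ∀ A B → A ∙ B ≡ B ∙ A
  ∙-comm ⟨ a , b , c ⟩ ⟨ d , e , f ⟩ = lemma a b c d e f
    where
    lemma : ∀ a b c d e f → a * d + b * e + c * f ≡ d * a + e * b + f * c
    lemma = solve-∀

  ⊕-∙ : ∀ A q B C → A ⊕[ q ] B ∙ C ≡ A ∙ C + q * (B ∙ C)
  ⊕-∙ ⟨ a , b , c ⟩ q ⟨ d , e , f ⟩ ⟨ g , h , i ⟩ = lemma a b c q d e f g h i
    where
    lemma : ∀ a b c q d e f g h i →
      (a + q * d) * g + (b + q * e) * h + (c + q * f) * i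
      ≡ a * g + b * h + c * i + q * (d * g + e * h + f * i)
    lemma = solve-∀

  ⊕-⨯ : ∀ A q B → A ⊕[ q ] B ⨯ B ≡ A ⨯ B
  ⊕-⨯ ⟨ a , b , c ⟩ q ⟨ d , e , f ⟩ = ⟨⟩-cong (lemma b c e f q) (lemma c a f d q) (lemma a b d e q)
    where
    lemma : ∀ a b c d q → (a + q * c) * d - (b + q * d) * c ≡ a * d - b * c
    lemma = solve-∀

  ⨯-⊕ : ∀ A q B → A ⨯ (B ⊕[ q ] A) ≡ A ⨯ B
  ⨯-⊕ ⟨ a , b , c ⟩ q ⟨ d , e , f ⟩ = ⟨⟩-cong (lemma b c e f q) (lemma c a f d q) (lemma a b d e q)
    where
    lemma : ∀ a b c d q → a * (d + q * b) - b * (c + q * a) ≡ a * d - b * c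
    lemma = solve-∀

  ∙-⨯-self : ∀ A B → A ∙ (B ⨯ A) ≡ 0ℤ
  ∙-⨯-self ⟨ a , b , c ⟩ ⟨ d , e , f ⟩ = lemma a b c d e f
    where
    lemma : ∀ a b c d e f → a * (e * c - f * b) + b * (f * a - d * c) + c * (d * b - e * a) ≡ 0ℤ
    lemma = solve-∀

  standard-basis : ⟨ 1ℤ , 0ℤ , 0ℤ ⟩ ∙ (⟨ 0ℤ , 1ℤ , 0ℤ ⟩ ⨯ ⟨ 0ℤ , 0ℤ , 1ℤ ⟩) ≡ 1ℤ
  standard-basis = refl

-- Cancellation and the local rule in product form

*-cancelˡ-pos : ∀ {i} j k → 0ℤ < i → i * j ≡ i * k → j ≡ k
*-cancelˡ-pos {i} j k 0<i = *-cancelˡ-≡ i j k {{ℤ.>-nonZero 0<i}}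

local-product : ∀ {m a} → IsClosed2Frieze m a → ∀ p → p ℕ.< m → ∀ c →
                a (suc p) (c - 1ℤ) * a (suc p) (c + 1ℤ) ≡ a (suc p) c + a p c * a (suc (suc p)) c
local-product {a = a} fr p p<m c =
  trans (rearrange _ (a p c * a (suc (suc p)) c)) (cong (_+ a p c * a (suc (suc p)) c) (sym (IsClosed2Frieze.local fr p p<m c)))
  where
  rearrange : ∀ i j → i ≡ i - j + j
  rearrange = solve-∀

-- Vector sequences with prescribed first row

record Frame : Set where
  constructor frame
  field
    v₀ v₁ v₂   : ℤ³
    unimodular : v₀ ∙ (v₁ ⨯ v₂) ≡ 1ℤ
open Frame

-- The new third vector must have cross product `C` with `B ⨯ C`, which fixes it up to multiples of
-- `B ⨯ C`. The coefficient `q` is this free choice, and it equals the dot product of `A` with the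
-- new vector.
next : ℤ → Frame → Frame
next q (frame A B C det) = frame (A ⨯ B) (B ⨯ C) (C ⨯ A ⊕[ q ] (B ⨯ C)) (begin
  A ⨯ B ∙ (B ⨯ C ⨯ (C ⨯ A ⊕[ q ] (B ⨯ C))) ≡⟨ cong (A ⨯ B ∙_) (⨯-⊕ (B ⨯ C) q (C ⨯ A)) ⟩
  A ⨯ B ∙ (B ⨯ C ⨯ (C ⨯ A))                ≡⟨ cong (A ⨯ B ∙_) (⨯-⨯ B C A (trans (∙-rotate B C A) det)) ⟩
  A ⨯ B ∙ C                                ≡⟨ ∙-comm (A ⨯ B) C ⟩
  C ∙ (A ⨯ B)                              ≡⟨ ∙-rotate A B C ⟨
  A ∙ (B ⨯ C)                              ≡⟨ det ⟩
  1ℤ                                       ∎)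

-- The state at n is (W n , W (2 + n) , W (4 + n)).
module VectorSequence (f : ℕ → ℤ) where

  frames : ℕ → Frame
  frames zero    = frame ⟨ 1ℤ , 0ℤ , 0ℤ ⟩ ⟨ 0ℤ , 1ℤ , 0ℤ ⟩ ⟨ 0ℤ , 0ℤ , 1ℤ ⟩ standard-basis
  frames (suc n) = next (f n) (frames n)

  W : ℕ → ℤ³
  W n = v₀ (frames n)

  -- Two steps turn the first vector `A` into `A ⨯ B ⨯ (B ⨯ C)`, which is `B` by unimodularity.
  v₁-frames : ∀ n → v₁ (frames n) ≡ W (2 ℕ.+ n)
  v₁-frames n = sym (⨯-⨯ (v₀ F) (v₁ F) (v₂ F) (unimodular F))
    where F = frames n

  v₂-frames : ∀ n → v₂ (frames n) ≡ W (4 ℕ.+ n)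
  v₂-frames n = begin
    C                                    ≡⟨ ⨯-⨯ B C A (trans (∙-rotate B C A) (unimodular F)) ⟨
    B ⨯ C ⨯ (C ⨯ A)                      ≡⟨ ⨯-⊕ (B ⨯ C) (f n) (C ⨯ A) ⟨
    B ⨯ C ⨯ (C ⨯ A ⊕[ f n ] (B ⨯ C))     ≡⟨⟩
    v₁ (frames (2 ℕ.+ n))                ≡⟨ v₁-frames (2 ℕ.+ n) ⟩
    W (4 ℕ.+ n)                          ∎
    where
    F = frames n
    A = v₀ F
    B = v₁ F
    C = v₂ F

  W-⨯ : ∀ n → W n ⨯ W (2 ℕ.+ n) ≡ W (1 ℕ.+ n)
  W-⨯ n = cong (W n ⨯_) (sym (v₁-frames n))

  W∙W₃ : ∀ n → W n ∙ W (3 ℕ.+ n) ≡ 1ℤ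
  W∙W₃ n = trans (cong (W n ∙_) (sym (v₁-frames (suc n)))) (unimodular (frames n))

  -- This is how `f` prescribes row 1: `C ⨯ A` is orthogonal to `A`, while `B ⨯ C` has product 1
  -- with `A`.
  W∙W₅ : ∀ n → W n ∙ W (5 ℕ.+ n) ≡ f n
  W∙W₅ n = begin
    A ∙ W (5 ℕ.+ n)                          ≡⟨ cong (A ∙_) (v₂-frames (suc n)) ⟨
    A ∙ (C ⨯ A ⊕[ f n ] (B ⨯ C))             ≡⟨ ∙-comm A _ ⟩
    C ⨯ A ⊕[ f n ] (B ⨯ C) ∙ A               ≡⟨ ⊕-∙ (C ⨯ A) (f n) (B ⨯ C) A ⟩
    C ⨯ A ∙ A + f n * (B ⨯ C ∙ A)            ≡⟨ cong₂ (λ i j → i + f n * j)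
                                                 (trans (∙-comm _ A) (∙-⨯-self A C))
                                                 (trans (∙-comm _ A) (unimodular F)) ⟩
    0ℤ + f n * 1ℤ                            ≡⟨ trans (+-identityˡ _) (*-identityʳ _) ⟩
    f n                                      ∎
    where
    F = frames n
    A = v₀ F
    B = v₁ F
    C = v₂ F

-- Realization of an integral frieze by vectors

-- Index of the second factor of the entry in row `r` whose first factor is `W s`.
far : ℕ → ℕ → ℕ
far r s = 3 ℕ.+ (r ℕ.* 2 ℕ.+ s)

far-suc : ∀ r s → far r (suc s) ≡ suc (far r s)
far-suc r s = cong (3 ℕ.+_) (ℕ.+-suc (r ℕ.* 2) s)

module Realization {m a} (int : IsIntegralClosed2Frieze m a) (base : ℤ) where
  open IsIntegralClosed2Frieze int
  open IsClosed2Frieze isClosed2Frieze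
  open VectorSequence (λ n → a 1 (base + + (2 ℕ.+ n))) public

  -- The column offset `1 + r + s` is the midpoint of the indices `s` and `far r s`, rounded down.
  Row : ℕ → Set
  Row r = ∀ s → a r (base + + (1 ℕ.+ r ℕ.+ s)) ≡ W s ∙ W (far r s)

  -- Rows 0 and 1 hold by the construction of `W`. After that, the local rule and the Binet-Cauchy
  -- identity put the entry of row `2 + p` and its dot product into the same equation, and the
  -- positive entry of row `p` can be cancelled.
  rows : ∀ p → p ℕ.≤ m → Row p × Row (suc p)
  rows zero    _     = (λ s → trans (top _) (sym (W∙W₃ s))) , (λ s → sym (W∙W₅ s))
  rows (suc p) p<m = row₁ , row₂
    where
    row₀ = proj₁ (rows p (ℕ.<⇒≤ p<m))
    row₁ = proj₂ (rows p (ℕ.<⇒≤ p<m))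
    row₂ : Row (2 ℕ.+ p)
    row₂ s = *-cancelˡ-pos _ _ (positive p (ℕ.m≤n⇒m≤1+n (ℕ.<⇒≤ p<m)) c) (+-cancelˡ (a (suc p) c) _ _ (begin
      a (suc p) c + a p c * a (2 ℕ.+ p) c                      ≡⟨ local-product isClosed2Frieze p p<m c ⟨
      a (suc p) (c - 1ℤ) * a (suc p) (c + 1ℤ)                  ≡⟨ cong₂ _*_ left right ⟩
      W s ∙ W t * (W (2 ℕ.+ s) ∙ W (2 ℕ.+ t))                  ≡⟨ binet-cauchy (W s) (W (2 ℕ.+ s)) (W t) (W (2 ℕ.+ t)) ⟩
      (W s ⨯ W (2 ℕ.+ s)) ∙ (W t ⨯ W (2 ℕ.+ t)) + W (2 ℕ.+ s) ∙ W t * (W s ∙ W (2 ℕ.+ t))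
                                                               ≡⟨ cong₂ (λ i j → i + j * (W s ∙ W (2 ℕ.+ t))) centre (sym above) ⟩
      a (suc p) c + a p c * (W s ∙ W (2 ℕ.+ t))                ∎))
      where
      c = base + + (3 ℕ.+ p ℕ.+ s)
      t = far (suc p) s
      column : ∀ n → base + + (1 ℕ.+ n) - 1ℤ ≡ base + + n
      column n = lemma base (+ n)
        where
        lemma : ∀ i j → i + (1ℤ + j) - 1ℤ ≡ i + j
        lemma = solve-∀
      left : a (suc p) (c - 1ℤ) ≡ W s ∙ W t
      left = trans (cong (a (suc p)) (column (2 ℕ.+ p ℕ.+ s))) (row₁ s)
      right : a (suc p) (c + 1ℤ) ≡ W (2 ℕ.+ s) ∙ W (2 ℕ.+ t)
      right = trans (cong (a (suc p)) index) (trans (row₁ (2 ℕ.+ s)) (cong (λ n → W (2 ℕ.+ s) ∙ W n)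
                (trans (far-suc (suc p) (suc s)) (cong suc (far-suc (suc p) s)))))
        where
        index : c + 1ℤ ≡ base + + (2 ℕ.+ p ℕ.+ (2 ℕ.+ s))
        index = trans (+-assoc base _ 1ℤ) (cong (λ n → base + + n)
          (trans (ℕ.+-comm _ 1) (cong (2 ℕ.+_) (sym (trans (ℕ.+-suc p (suc s)) (cong suc (ℕ.+-suc p s)))))))
      centre : (W s ⨯ W (2 ℕ.+ s)) ∙ (W t ⨯ W (2 ℕ.+ t)) ≡ a (suc p) c
      centre = begin
        (W s ⨯ W (2 ℕ.+ s)) ∙ (W t ⨯ W (2 ℕ.+ t)) ≡⟨ cong₂ _∙_ (W-⨯ s) (W-⨯ t) ⟩
        W (suc s) ∙ W (suc t)                     ≡⟨ cong (λ n → W (suc s) ∙ W n) (far-suc (suc p) s) ⟨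
        W (suc s) ∙ W (far (suc p) (suc s))       ≡⟨ row₁ (suc s) ⟨
        a (suc p) (base + + (2 ℕ.+ p ℕ.+ suc s))  ≡⟨ cong (λ n → a (suc p) (base + + (2 ℕ.+ n))) (ℕ.+-suc p s) ⟩
        a (suc p) c                               ∎
      above : a p c ≡ W (2 ℕ.+ s) ∙ W t
      above = trans (cong (λ n → a p (base + + (1 ℕ.+ n))) (sym (trans (ℕ.+-suc p (suc s)) (cong suc (ℕ.+-suc p s)))))
                (trans (row₀ (2 ℕ.+ s)) (cong (λ n → W (2 ℕ.+ s) ∙ W n)
                  (trans (far-suc p (suc s)) (cong suc (far-suc p s)))))

  entry-at : ∀ {r c} s t → r ℕ.≤ suc m → c ≡ base + + (1 ℕ.+ r ℕ.+ s) → t ≡ far r s → a r c ≡ W s ∙ W t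
  entry-at {zero}  s _ _         refl refl = proj₁ (rows zero z≤n) s
  entry-at {suc r} s _ (s≤s r≤m) refl refl = proj₂ (rows r r≤m) s

-- Necessity: comparing two friezes that share two columns

-- One side of a frieze, with columns counted away from a starting column. The product form of the
-- rule is symmetric in the outer columns, so one notion serves both directions. Row `suc k` is not
-- asked to consist of 1s, since in `a` it need not.
record IsHalfFrieze (k : ℕ) (A : ℕ → ℕ → ℤ) : Set where
  field
    top      : ∀ t → A 0 t ≡ 1ℤ
    local    : ∀ p → p ℕ.< k → ∀ t →
               A (suc p) t * A (suc p) (2 ℕ.+ t)
                 ≡ A (suc p) (1 ℕ.+ t) + A p (1 ℕ.+ t) * A (2 ℕ.+ p) (1 ℕ.+ t)
    positive : ∀ r → r ℕ.≤ k → ∀ t → 0ℤ < A r t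

module _ {k m a} (k≤m : k ℕ.≤ m) (int : IsIntegralClosed2Frieze m a) (c : ℤ) where
  open IsIntegralClosed2Frieze int
  open IsClosed2Frieze isClosed2Frieze

  rightHalf : IsHalfFrieze k (λ r t → a r (c + + t))
  rightHalf = record
    { top      = λ t → top _
    ; local    = λ p p<k t → trans
        (cong₂ (λ i j → a (suc p) i * a (suc p) j) (lemma₁ c (+ t)) (lemma₂ c (+ t)))
        (local-product isClosed2Frieze p (ℕ.<-≤-trans p<k k≤m) (c + + (1 ℕ.+ t)))
    ; positive = λ r r≤k t → positive r (ℕ.m≤n⇒m≤1+n (ℕ.≤-trans r≤k k≤m)) _
    }
    where
    lemma₁ : ∀ c t → c + t ≡ c + (1ℤ + t) - 1ℤ
    lemma₁ = solve-∀
    lemma₂ : ∀ c t → c + (+ 2 + t) ≡ c + (1ℤ + t) + 1ℤ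
    lemma₂ = solve-∀

  leftHalf : IsHalfFrieze k (λ r t → a r (c - + t))
  leftHalf = record
    { top      = λ t → top _
    ; local    = λ p p<k t → trans
        (cong₂ (λ i j → a (suc p) i * a (suc p) j) (lemma₁ c (+ t)) (lemma₂ c (+ t)))
        (trans (*-comm (a (suc p) _) _)
               (local-product isClosed2Frieze p (ℕ.<-≤-trans p<k k≤m) (c - + (1 ℕ.+ t))))
    ; positive = λ r r≤k t → positive r (ℕ.m≤n⇒m≤1+n (ℕ.≤-trans r≤k k≤m)) _
    }
    where
    lemma₁ : ∀ c t → c - t ≡ c - (1ℤ + t) + 1ℤ
    lemma₁ = solve-∀
    lemma₂ : ∀ c t → c - (+ 2 + t) ≡ c - (1ℤ + t) - 1ℤ
    lemma₂ = solve-∀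

module Comparison {k A B} (halfA : IsHalfFrieze k A) (halfB : IsHalfFrieze k B)
                  (column₀ : ∀ r → r ℕ.≤ k → A r 0 ≡ B r 0)
                  (column₁ : ∀ r → r ℕ.≤ k → A r 1 ≡ B r 1)
                  (bottom  : B (suc k) 1 ≡ 1ℤ) where
  private
    module A = IsHalfFrieze halfA
    module B = IsHalfFrieze halfB

  -- An entry in column `2 + t` depends on the two columns before it and on one row further down, so
  -- each new column loses a row. The resulting triangle never reaches row `suc k`, where `A` and
  -- `B` may differ.
  agree : ∀ t r → r ℕ.≤ k → t ℕ.+ r ℕ.≤ suc k → A r t ≡ B r t
  agree 0             r       r≤k _   = column₀ r r≤k
  agree 1             r       r≤k _   = column₁ r r≤k
  agree (suc (suc t)) zero    r≤k _   = trans (A.top _) (sym (B.top _))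
  agree (suc (suc t)) (suc p) p<k (s≤s lt) =
    *-cancelˡ-pos _ _ (A.positive (suc p) p<k t) (begin
      A (suc p) t * A (suc p) (2 ℕ.+ t)
        ≡⟨ A.local p p<k t ⟩
      A (suc p) (1 ℕ.+ t) + A p (1 ℕ.+ t) * A (2 ℕ.+ p) (1 ℕ.+ t)
        ≡⟨ cong₂ _+_ (agree (suc t) (suc p) p<k lt′)
           (cong₂ _*_ (agree (suc t) p (ℕ.<⇒≤ p<k) (ℕ.≤-trans (ℕ.+-monoʳ-≤ (suc t) (ℕ.n≤1+n p)) lt′))
                      (agree (suc t) (2 ℕ.+ p) (ℕ.≤-trans (s≤s (ℕ.m≤n+m (suc p) t)) lt)
                             (subst (ℕ._≤ suc k) (cong suc (sym (ℕ.+-suc t (suc p)))) (s≤s lt)))) ⟩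
      B (suc p) (1 ℕ.+ t) + B p (1 ℕ.+ t) * B (2 ℕ.+ p) (1 ℕ.+ t)
        ≡⟨ B.local p p<k t ⟨
      B (suc p) t * B (suc p) (2 ℕ.+ t)
        ≡⟨ cong (_* B (suc p) (2 ℕ.+ t))
             (agree t (suc p) p<k (ℕ.≤-trans (ℕ.n≤1+n _) lt′)) ⟨
      A (suc p) t * B (suc p) (2 ℕ.+ t)
        ∎)
    where
    lt′ : suc t ℕ.+ suc p ℕ.≤ suc k
    lt′ = ℕ.m≤n⇒m≤1+n lt

  -- This concerns the diagonal just outside the triangle of agreement. Subtracting the two local
  -- rules there shows that the ratio of `A - B` at `(suc p , suc t)` to `A p t` is constant along
  -- the diagonal; its value is read off at the lower end, where `B` is 1.
  difference : ∀ t p → t ℕ.+ p ≡ k →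
               A k 0 * (A (suc p) (suc t) - B (suc p) (suc t)) ≡ A p t * (A (suc k) 1 - 1ℤ)
  difference zero    p refl = cong (λ b → A p 0 * (A (suc p) 1 - b)) bottom
  difference (suc t) p refl = *-cancelˡ-pos _ _ (A.positive (suc p) p<k t)
    (combine (A (suc p) t) (A k 0) (A (suc p) (2 ℕ.+ t)) (B (suc p) (2 ℕ.+ t)) (A (suc p) (1 ℕ.+ t)) (A p (1 ℕ.+ t))
             (A (2 ℕ.+ p) (1 ℕ.+ t)) (B (2 ℕ.+ p) (1 ℕ.+ t)) (A (suc k) 1 - 1ℤ) (A.local p p<k t)
      (begin
        A (suc p) t * B (suc p) (2 ℕ.+ t)
          ≡⟨ cong (_* B (suc p) (2 ℕ.+ t)) (agree t (suc p) p<k (ℕ.≤-trans (ℕ.n≤1+n _) bound)) ⟩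
        B (suc p) t * B (suc p) (2 ℕ.+ t)
          ≡⟨ B.local p p<k t ⟩
        B (suc p) (1 ℕ.+ t) + B p (1 ℕ.+ t) * B (2 ℕ.+ p) (1 ℕ.+ t)
          ≡⟨ cong₂ (λ i j → i + j * B (2 ℕ.+ p) (1 ℕ.+ t))
               (agree (suc t) (suc p) p<k bound) (agree (suc t) p (ℕ.<⇒≤ p<k) (ℕ.n≤1+n _)) ⟨
        A (suc p) (1 ℕ.+ t) + A p (1 ℕ.+ t) * B (2 ℕ.+ p) (1 ℕ.+ t)
          ∎)
      (difference t (suc p) (ℕ.+-suc t p)))
    where
    p<k : p ℕ.< suc t ℕ.+ p
    p<k = s≤s (ℕ.m≤n+m p t)
    bound : suc t ℕ.+ suc p ℕ.≤ 2 ℕ.+ (t ℕ.+ p)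
    bound = ℕ.≤-reflexive (cong suc (ℕ.+-suc t p))
    expand : ∀ h y X Y → h * (y * (X - Y)) ≡ y * (h * X - h * Y)
    expand = solve-∀
    collect : ∀ y n g Z Z′ → y * (n + g * Z - (n + g * Z′)) ≡ g * (y * (Z - Z′))
    collect = solve-∀
    swap : ∀ g h u → g * (h * u) ≡ h * (g * u)
    swap = solve-∀
    combine : ∀ h y X Y n g Z Z′ u → h * X ≡ n + g * Z → h * Y ≡ n + g * Z′ →
              y * (Z - Z′) ≡ h * u → h * (y * (X - Y)) ≡ h * (g * u)
    combine h y X Y n g Z Z′ u eqX eqY eq = begin
      h * (y * (X - Y))                     ≡⟨ expand h y X Y ⟩
      y * (h * X - h * Y)                   ≡⟨ cong₂ (λ i j → y * (i - j)) eqX eqY ⟩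
      y * (n + g * Z - (n + g * Z′))        ≡⟨ collect y n g Z Z′ ⟩
      g * (y * (Z - Z′))                    ≡⟨ cong (g *_) eq ⟩
      g * (h * u)                           ≡⟨ swap g h u ⟩
      h * (g * u)                           ∎

  -- At the upper end of the diagonal `A 0 k` is 1, so the difference in row 1 is the integer
  -- quotient.
  congruence : A (suc k) 1 ≡ 1ℤ mod A k 0
  congruence = divides (A 1 (suc k) - B 1 (suc k)) (begin
    A (suc k) 1 - 1ℤ                             ≡⟨ *-identityˡ _ ⟨
    1ℤ * (A (suc k) 1 - 1ℤ)                      ≡⟨ cong (_* (A (suc k) 1 - 1ℤ)) (A.top k) ⟨
    A 0 k * (A (suc k) 1 - 1ℤ)                   ≡⟨ difference k 0 (ℕ.+-identityʳ k) ⟨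
    A k 0 * (A 1 (suc k) - B 1 (suc k))          ≡⟨ *-comm (A k 0) _ ⟩
    (A 1 (suc k) - B 1 (suc k)) * A k 0          ∎)

-- Residues, two-sided induction and periodic sequences

-- Two residues below `d` differ by a multiple of `d` whose absolute value is less than `d`, hence
-- by 0.
%ℕ-unique : ∀ {r d} n q .{{_ : ℕ.NonZero d}} → r ℕ.< d → n ≡ + r + q * + d → n %ℕ d ≡ r
%ℕ-unique {r} {d} n q r<d eq = +-injective (i-j≡0⇒i≡j (+ r′) (+ r) (∣i∣≡0⇒i≡0 (small ∣ + r′ - + r ∣ refl)))
  where
  r′ = n %ℕ d
  q′ = n /ℕ d
  bound : ∣ + r′ - + r ∣ ℕ.< d
  bound = subst (λ i → ∣ i ∣ ℕ.< d) (sym (m-n≡m⊖n r′ r))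
    (ℕ.≤-<-trans (∣m⊝n∣≤m⊔n r′ r) (ℕ.⊔-lub (n%ℕd<d n d) r<d))
  multiple : + r′ - + r ≡ (q - q′) * + d
  multiple = trans (cancel (+ r′) (+ r) q′ q (+ d))
    (trans (cong (λ i → i - (+ r + q * + d) + (q - q′) * + d)
             (trans (sym (a≡a%ℕn+[a/ℕn]*n n d)) eq))
           (trans (cong (_+ (q - q′) * + d) (+-inverseʳ (+ r + q * + d))) (+-identityˡ _)))
    where
    cancel : ∀ r′ r q′ q d → r′ - r ≡ r′ + q′ * d - (r + q * d) + (q - q′) * d
    cancel = solve-∀
  small : ∀ j → ∣ + r′ - + r ∣ ≡ j → j ≡ 0
  small zero    _  = refl
  small (suc j) eq = contradiction
    (ℕ.divides ∣ q - q′ ∣ (trans (cong ∣_∣ multiple) (abs-* (q - q′) (+ d))))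
    (subst (λ i → d ℕ.∤ i) (sym eq) (ℕ.>⇒∤ (subst (ℕ._< d) eq bound)))

ℤ-induction : (P : ℤ → Set) → P 0ℤ → (∀ n → P n → P (n + 1ℤ)) → (∀ n → P (n + 1ℤ) → P n) → ∀ n → P n
ℤ-induction P base up down = λ { (+ n) → forwards n ; -[1+ n ] → backwards n }
  where
  forwards : ∀ n → P (+ n)
  forwards zero    = base
  forwards (suc n) = subst P (cong +_ (ℕ.+-comm n 1)) (up (+ n) (forwards n))
  backwards : ∀ n → P -[1+ n ]
  backwards zero    = down -[1+ 0 ] base
  backwards (suc n) = down -[1+ suc n ] (backwards n)

module Periodic {X : Set} (L : ℕ) (g : ℕ → X) where

  period : ℕ
  period = 2 ℕ.+ L

  extend : ℤ → X
  extend n = g (n %ℕ period)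

  extend-≡ : ∀ {r} n q → r ℕ.< period → n ≡ + r + q * + period → extend n ≡ g r
  extend-≡ n q r<d eq = cong g (%ℕ-unique n q r<d eq)

  extend-+ : ∀ {n} → n ℕ.< period → extend (+ n) ≡ g n
  extend-+ {n} n<d = extend-≡ (+ n) 0ℤ n<d (sym (+-identityʳ (+ n)))

  extend-periodic : ∀ n → extend (n + + period) ≡ extend n
  extend-periodic n = extend-≡ (n + + period) (n /ℕ period + 1ℤ) (n%ℕd<d n period)
    (trans (cong (_+ + period) (a≡a%ℕn+[a/ℕn]*n n period)) (lemma (+ (n %ℕ period)) (n /ℕ period) (+ period)))
    where
    lemma : ∀ r q d → r + q * d + d ≡ r + (q + 1ℤ) * d
    lemma = solve-∀

  -- A triple starting at a residue below `L` stays inside one period; only those starting at `L`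
  -- and `1 + L` run over its end.
  extend-triples : (T : X → X → X → Set) →
                   (∀ i → T (g i) (g (1 ℕ.+ i)) (g (2 ℕ.+ i))) →
                   T (g L) (g (1 ℕ.+ L)) (g 0) → T (g (1 ℕ.+ L)) (g 0) (g 1) →
                   ∀ n → T (extend n) (extend (n + 1ℤ)) (extend (n + + 2))
  extend-triples T inner wrap₁ wrap₂ n = cases (n %ℕ period) (n%ℕd<d n period) refl
    where
    q = n /ℕ period
    offset : ∀ {i} j {l} → n %ℕ period ≡ i → l ℕ.< period → i ℕ.+ j ≡ l → extend (n + + j) ≡ g l
    offset {i} j refl l<d refl = extend-≡ (n + + j) q l<d
      (trans (cong (_+ + j) (a≡a%ℕn+[a/ℕn]*n n period)) (lemma (+ i) (q * + period) (+ j)))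
      where
      lemma : ∀ i m j → i + m + j ≡ i + j + m
      lemma = solve-∀
    wrap : ∀ {i} j {l} → n %ℕ period ≡ i → l ℕ.< period → i ℕ.+ j ≡ l ℕ.+ period → extend (n + + j) ≡ g l
    wrap {i} j {l} refl l<d eq = extend-≡ (n + + j) (q + 1ℤ) l<d (begin
      n + + j                                  ≡⟨ cong (_+ + j) (a≡a%ℕn+[a/ℕn]*n n period) ⟩
      + i + q * + period + + j                 ≡⟨ lemma₁ (+ i) (q * + period) (+ j) ⟩
      + (i ℕ.+ j) + q * + period               ≡⟨ cong (λ k → + k + q * + period) eq ⟩
      + l + + period + q * + period            ≡⟨ lemma₂ (+ l) q (+ period) ⟩
      + l + (q + 1ℤ) * + period                ∎)
      where
      lemma₁ : ∀ i m j → i + m + j ≡ i + j + m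
      lemma₁ = solve-∀
      lemma₂ : ∀ l q d → l + d + q * d ≡ l + (q + 1ℤ) * d
      lemma₂ = solve-∀
    conclude : ∀ {x y z} → extend n ≡ x → extend (n + 1ℤ) ≡ y → extend (n + + 2) ≡ z → T x y z →
               T (extend n) (extend (n + 1ℤ)) (extend (n + + 2))
    conclude eq₀ eq₁ eq₂ t rewrite eq₀ | eq₁ | eq₂ = t
    cases : ∀ i → i ℕ.< period → n %ℕ period ≡ i → T (extend n) (extend (n + 1ℤ)) (extend (n + + 2))
    cases i (s≤s i≤1+L) eq with ℕ.m≤n⇒m<n∨m≡n i≤1+L
    ... | inj₂ refl = conclude (cong g eq) (wrap 1 eq (s≤s z≤n) (ℕ.+-comm i 1))
                        (wrap 2 eq (s≤s (s≤s z≤n)) (ℕ.+-comm i 2)) wrap₂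
    ... | inj₁ (s≤s i≤L) with ℕ.m≤n⇒m<n∨m≡n i≤L
    ...   | inj₂ refl = conclude (cong g eq) (offset 1 eq ℕ.≤-refl (ℕ.+-comm i 1))
                          (wrap 2 eq (s≤s z≤n) (ℕ.+-comm i 2)) wrap₁
    ...   | inj₁ i<L  = conclude (cong g eq) (offset 1 eq (s≤s (s≤s (ℕ.<⇒≤ i<L))) (ℕ.+-comm i 1))
                          (offset 2 eq (s≤s (s≤s i<L)) (ℕ.+-comm i 2)) (inner i)

-- Positivity from two adjacent columns

*-pos : ∀ {i j} → 0ℤ < i → 0ℤ < j → 0ℤ < i * j
*-pos {i} {j} 0<i 0<j = subst (_< i * j) (*-zeroʳ i) (*-monoˡ-<-pos i {{ℤ.positive 0<i}} 0<j)

*-pos⁻¹ʳ : ∀ {i j} → 0ℤ < i → 0ℤ < i * j → 0ℤ < j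
*-pos⁻¹ʳ {i} {j} 0<i 0<ij =
  *-cancelˡ-<-nonNeg i {{ℤ.nonNegative (<⇒≤ 0<i)}} (subst (_< i * j) (sym (*-zeroʳ i)) 0<ij)

-- The local rule makes the product of the two outer entries a sum of positive terms, so positivity
-- of two adjacent columns passes to the next column on either side.
positive-columns : ∀ {k w} → IsClosed2Frieze k w → (∀ r → r ℕ.≤ k → 0ℤ < w r 0ℤ) →
                   (∀ r → r ℕ.≤ k → 0ℤ < w r 1ℤ) → ∀ r → r ℕ.≤ suc k → ∀ c → 0ℤ < w r c
positive-columns {k} {w} fr column₀ column₁ r r≤1+k c =
  proj₁ (ℤ-induction Columns (column column₀ , column column₁) up down c) r r≤1+k
  where
  open IsClosed2Frieze fr
  0<1 : 0ℤ < 1ℤ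
  0<1 = +<+ (s≤s z≤n)
  Column : ℤ → Set
  Column c = ∀ r → r ℕ.≤ suc k → 0ℤ < w r c
  Columns : ℤ → Set
  Columns c = Column c × Column (c + 1ℤ)
  column : ∀ {c} → (∀ r → r ℕ.≤ k → 0ℤ < w r c) → Column c
  column pos r r≤1+k with ℕ.m≤n⇒m<n∨m≡n r≤1+k
  ... | inj₁ (s≤s r≤k) = pos r r≤k
  ... | inj₂ refl      = subst (0ℤ <_) (sym (bottom _)) 0<1
  inner : ∀ {c} → (∀ p → p ℕ.< k → 0ℤ < w (suc p) c) → Column c
  inner pos = column λ { zero _ → subst (0ℤ <_) (sym (top _)) 0<1 ; (suc p) p<k → pos p p<k }
  product-pos : ∀ c → Column c → ∀ p → p ℕ.< k → 0ℤ < w (suc p) (c - 1ℤ) * w (suc p) (c + 1ℤ)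
  product-pos c pos p p<k = subst (0ℤ <_) (sym (local-product fr p p<k c))
    (+-mono-< (pos (suc p) (s≤s (ℕ.<⇒≤ p<k)))
              (*-pos (pos p (ℕ.m≤n⇒m≤1+n (ℕ.<⇒≤ p<k))) (pos (2 ℕ.+ p) (s≤s p<k))))
  c+1-1 : ∀ c → c + 1ℤ - 1ℤ ≡ c
  c+1-1 = solve-∀
  up : ∀ c → Columns c → Columns (c + 1ℤ)
  up c (pos , pos′) = pos′ , inner λ p p<k →
    *-pos⁻¹ʳ (subst (λ c → 0ℤ < w (suc p) c) (sym (c+1-1 c)) (pos (suc p) (s≤s (ℕ.<⇒≤ p<k))))
             (product-pos (c + 1ℤ) pos′ p p<k)
  down : ∀ c → Columns (c + 1ℤ) → Columns c
  down c (pos , pos′) = (inner λ p p<k → subst (λ c → 0ℤ < w (suc p) c) (c+1-1 c)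
    (*-pos⁻¹ʳ (pos′ (suc p) (s≤s (ℕ.<⇒≤ p<k)))
              (subst (0ℤ <_) (*-comm (w (suc p) _) _) (product-pos (c + 1ℤ) pos p p<k)))) , pos

-- Friezes from sequences with the cross product rule

module SequenceFrieze (E : ℤ → ℤ³) (E-⨯ : ∀ n → E n ⨯ E (n + + 2) ≡ E (n + 1ℤ)) where

  -- Columns are numbered so that row 0 is `E c ∙ E (c + 3)`.
  entry : ℕ → ℤ → ℤ
  entry r c = E (c - + r) ∙ E (c + + (3 ℕ.+ r))

  -- Both sides are the determinant of `E n`, `E (n + 2)`, `E (n + 4)`.
  E∙E₃-step : ∀ n → E (n + 1ℤ) ∙ E (n + 1ℤ + + 3) ≡ E n ∙ E (n + + 3)
  E∙E₃-step n = begin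
    E (n + 1ℤ) ∙ E (n + 1ℤ + + 3)          ≡⟨ ∙-comm (E (n + 1ℤ)) _ ⟩
    E (n + 1ℤ + + 3) ∙ E (n + 1ℤ)          ≡⟨ cong₂ (λ i v → E i ∙ v) (index₁ n) (sym (E-⨯ n)) ⟩
    E (n + + 2 + + 2) ∙ (E n ⨯ E (n + + 2)) ≡⟨ ∙-rotate (E n) (E (n + + 2)) (E (n + + 2 + + 2)) ⟨
    E n ∙ (E (n + + 2) ⨯ E (n + + 2 + + 2)) ≡⟨ cong (E n ∙_) (trans (E-⨯ (n + + 2)) (cong E (index₂ n))) ⟩
    E n ∙ E (n + + 3)                       ∎
    where
    index₁ : ∀ n → n + 1ℤ + + 3 ≡ n + + 2 + + 2
    index₁ = solve-∀
    index₂ : ∀ n → n + + 2 + 1ℤ ≡ n + + 3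
    index₂ = solve-∀

  E∙E₃-constant : ∀ n → E n ∙ E (n + + 3) ≡ E 0ℤ ∙ E (+ 3)
  E∙E₃-constant = ℤ-induction (λ n → E n ∙ E (n + + 3) ≡ E 0ℤ ∙ E (+ 3)) refl
    (λ n eq → trans (E∙E₃-step n) eq) (λ n eq → trans (sym (E∙E₃-step n)) eq)

  entry-local : ∀ p c → entry (suc p) c
                  ≡ entry (suc p) (c - 1ℤ) * entry (suc p) (c + 1ℤ) - entry p c * entry (2 ℕ.+ p) c
  entry-local p c = begin
    E (c - + suc p) ∙ E (c + + (4 ℕ.+ p))
      ≡⟨ cong₂ (λ i j → E i ∙ E j) (centre₁ c (+ p)) (centre₂ c (+ p)) ⟩
    E (s + 1ℤ) ∙ E (t + 1ℤ)
      ≡⟨ cong₂ _∙_ (E-⨯ s) (E-⨯ t) ⟨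
    (E s ⨯ E (s + + 2)) ∙ (E t ⨯ E (t + + 2))
      ≡⟨ insert _ (E (s + + 2) ∙ E t * (E s ∙ E (t + + 2))) ⟩
    (E s ⨯ E (s + + 2)) ∙ (E t ⨯ E (t + + 2)) + E (s + + 2) ∙ E t * (E s ∙ E (t + + 2))
      - E (s + + 2) ∙ E t * (E s ∙ E (t + + 2))
      ≡⟨ cong (_- E (s + + 2) ∙ E t * (E s ∙ E (t + + 2))) (binet-cauchy (E s) (E (s + + 2)) (E t) (E (t + + 2))) ⟨
    E s ∙ E t * (E (s + + 2) ∙ E (t + + 2)) - E (s + + 2) ∙ E t * (E s ∙ E (t + + 2))
      ≡⟨ cong₂ _-_ (cong₂ _*_ left right) (cong₂ _*_ above below) ⟨
    entry (suc p) (c - 1ℤ) * entry (suc p) (c + 1ℤ) - entry p c * entry (2 ℕ.+ p) c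
      ∎
    where
    s = c - + (2 ℕ.+ p)
    t = c + + (3 ℕ.+ p)
    insert : ∀ i j → i ≡ i + j - j
    insert = solve-∀
    centre₁ : ∀ c p → c - (1ℤ + p) ≡ c - (+ 2 + p) + 1ℤ
    centre₁ = solve-∀
    centre₂ : ∀ c p → c + (+ 4 + p) ≡ c + (+ 3 + p) + 1ℤ
    centre₂ = solve-∀
    left₁ : ∀ c p → c - 1ℤ - (1ℤ + p) ≡ c - (+ 2 + p)
    left₁ = solve-∀
    left₂ : ∀ c p → c - 1ℤ + (+ 4 + p) ≡ c + (+ 3 + p)
    left₂ = solve-∀
    right₁ : ∀ c p → c + 1ℤ - (1ℤ + p) ≡ c - (+ 2 + p) + + 2
    right₁ = solve-∀
    right₂ : ∀ c p → c + 1ℤ + (+ 4 + p) ≡ c + (+ 3 + p) + + 2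
    right₂ = solve-∀
    above₁ : ∀ c p → c - p ≡ c - (+ 2 + p) + + 2
    above₁ = solve-∀
    below₂ : ∀ c p → c + (+ 5 + p) ≡ c + (+ 3 + p) + + 2
    below₂ = solve-∀
    left : entry (suc p) (c - 1ℤ) ≡ E s ∙ E t
    left = cong₂ (λ i j → E i ∙ E j) (left₁ c (+ p)) (left₂ c (+ p))
    right : entry (suc p) (c + 1ℤ) ≡ E (s + + 2) ∙ E (t + + 2)
    right = cong₂ (λ i j → E i ∙ E j) (right₁ c (+ p)) (right₂ c (+ p))
    above : entry p c ≡ E (s + + 2) ∙ E t
    above = cong (λ i → E i ∙ E t) (above₁ c (+ p))
    below : entry (2 ℕ.+ p) c ≡ E s ∙ E (t + + 2)
    below = cong (λ j → E s ∙ E j) (below₂ c (+ p))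

-- Sufficiency: closing up the stretch below the cut

cancel-residue : ∀ i j q → i - 1ℤ ≡ q * j → i + - q * j ≡ 1ℤ
cancel-residue i j q eq = begin
  i + - q * j                ≡⟨ expand i j q ⟩
  i - 1ℤ - q * j + 1ℤ        ≡⟨ cong (λ n → n - q * j + 1ℤ) eq ⟩
  q * j - q * j + 1ℤ         ≡⟨ cong (_+ 1ℤ) (+-inverseʳ (q * j)) ⟩
  1ℤ                         ∎
  where
  expand : ∀ i j q → i + - q * j ≡ i - 1ℤ - q * j + 1ℤ
  expand = solve-∀

module Cut {m a} (int : IsIntegralClosed2Frieze m a) {k} (k≤m : k ℕ.≤ m) (c : ℤ)
           (u≡1 : a (suc k) c ≡ 1ℤ mod a k (c + 1ℤ)) (v≡1 : a (suc k) (c + 1ℤ) ≡ 1ℤ mod a k c) where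
  -- This base gives the columns `c` and `c + 1` the offsets `2 + k` and `3 + k`. The stretch P, P ×
  -- Q, Q, ..., R, R × S, S is then `W 0`, `W 1`, `W 2`, ..., `W (1 + N)`, `W (2 + N)`, `W (3 + N)`.
  open Realization int (c - + (2 ℕ.+ k))
  open _∣_ u≡1 renaming (quotient to q; equality to u-1)
  open _∣_ v≡1 renaming (quotient to q′; equality to v-1)

  N : ℕ
  N = 3 ℕ.+ k ℕ.* 2

  c₀ : ∀ c k → c ≡ c - (+ 2 + k) + (+ 2 + k)
  c₀ = solve-∀
  c₁ : ∀ c k → c + 1ℤ ≡ c - (+ 2 + k) + (+ 3 + k)
  c₁ = solve-∀

  x-≡ : a k c ≡ W 1 ∙ W (1 ℕ.+ N)
  x-≡ = entry-at 1 (1 ℕ.+ N) (ℕ.m≤n⇒m≤1+n k≤m)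
    (trans (c₀ c (+ k)) (cong (λ n → c - + (2 ℕ.+ k) + + (1 ℕ.+ n)) (ℕ.+-comm 1 k)))
    (cong (3 ℕ.+_) (ℕ.+-comm 1 (k ℕ.* 2)))

  y-≡ : a k (c + 1ℤ) ≡ W 2 ∙ W (2 ℕ.+ N)
  y-≡ = entry-at 2 (2 ℕ.+ N) (ℕ.m≤n⇒m≤1+n k≤m)
    (trans (c₁ c (+ k)) (cong (λ n → c - + (2 ℕ.+ k) + + (1 ℕ.+ n)) (ℕ.+-comm 2 k)))
    (cong (3 ℕ.+_) (ℕ.+-comm 2 (k ℕ.* 2)))

  u-≡ : a (suc k) c ≡ W 0 ∙ W (2 ℕ.+ N)
  u-≡ = entry-at 0 (2 ℕ.+ N) (s≤s k≤m)
    (trans (c₀ c (+ k)) (cong (λ n → c - + (2 ℕ.+ k) + + (2 ℕ.+ n)) (sym (ℕ.+-identityʳ k))))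
    (cong (5 ℕ.+_) (sym (ℕ.+-identityʳ (k ℕ.* 2))))

  v-≡ : a (suc k) (c + 1ℤ) ≡ W 1 ∙ W (3 ℕ.+ N)
  v-≡ = entry-at 1 (3 ℕ.+ N) (s≤s k≤m)
    (trans (c₁ c (+ k)) (cong (λ n → c - + (2 ℕ.+ k) + + (2 ℕ.+ n)) (ℕ.+-comm 1 k)))
    (cong (5 ℕ.+_) (ℕ.+-comm 1 (k ℕ.* 2)))

  -- Subtracting multiples of `W 2` and `W (1 + N)` keeps the cross products with these vectors,
  -- while the products with `W (2 + N)` and `W 1` drop from `u` and `v` to 1.
  P′ S′ : ℤ³
  P′ = W 0 ⊕[ - q ] W 2
  S′ = W (3 ℕ.+ N) ⊕[ - q′ ] W (1 ℕ.+ N)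

  P′∙W : P′ ∙ W (2 ℕ.+ N) ≡ 1ℤ
  P′∙W = trans (⊕-∙ (W 0) (- q) (W 2) (W (2 ℕ.+ N)))
    (cancel-residue (W 0 ∙ W (2 ℕ.+ N)) _ q (trans (cong (_- 1ℤ) (sym u-≡)) (trans u-1 (cong (q *_) y-≡))))

  S′∙W : S′ ∙ W 1 ≡ 1ℤ
  S′∙W = trans (⊕-∙ (W (3 ℕ.+ N)) (- q′) (W (1 ℕ.+ N)) (W 1))
    (trans (cong₂ (λ i j → i + - q′ * j) (∙-comm _ (W 1)) (∙-comm _ (W 1)))
      (cancel-residue (W 1 ∙ W (3 ℕ.+ N)) _ q′ (trans (cong (_- 1ℤ) (sym v-≡)) (trans v-1 (cong (q′ *_) x-≡)))))

  P′-⨯ : P′ ⨯ W 2 ≡ W 1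
  P′-⨯ = trans (⊕-⨯ (W 0) (- q) (W 2)) (W-⨯ 0)

  ⨯-S′ : W (1 ℕ.+ N) ⨯ S′ ≡ W (2 ℕ.+ N)
  ⨯-S′ = trans (⨯-⊕ (W (1 ℕ.+ N)) (- q′) (W (3 ℕ.+ N))) (W-⨯ (1 ℕ.+ N))

  -- One period has `5 + N = 2 (k + 4)` terms, the last being `W (2 + N)`: the vertices of an
  -- SL₃-polygon with `k + 4` vertices, interleaved with their cross products.
  cycle : ℕ → ℤ³
  cycle 0                   = S′
  cycle 1                   = S′ ⨯ P′
  cycle 2                   = P′
  cycle (suc (suc (suc n))) = W (suc n)

  open Periodic (3 ℕ.+ N) cycle

  extend-⨯ : ∀ n → extend n ⨯ extend (n + + 2) ≡ extend (n + 1ℤ)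
  extend-⨯ = extend-triples (λ A B C → A ⨯ C ≡ B) inner ⨯-S′ wrap
    where
    inner : ∀ i → cycle i ⨯ cycle (2 ℕ.+ i) ≡ cycle (1 ℕ.+ i)
    inner 0                   = refl
    -- The congruence for `v` enters here: `S′`, `P′`, `W 2` is unimodular because `S′ ∙ W 1` is 1.
    inner 1                   = trans (cong (S′ ⨯ P′ ⨯_) (sym P′-⨯))
                                  (⨯-⨯ S′ P′ (W 2) (trans (cong (S′ ∙_) P′-⨯) S′∙W))
    inner 2                   = P′-⨯
    inner (suc (suc (suc i))) = W-⨯ (suc i)
    -- The congruence for `u` enters here: `W (1 + N)`, `S′`, `P′` is unimodular because
    -- `P′ ∙ W (2 + N)` is 1.
    wrap : W (2 ℕ.+ N) ⨯ (S′ ⨯ P′) ≡ S′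
    wrap = trans (cong (_⨯ (S′ ⨯ P′)) (sym ⨯-S′)) (⨯-⨯ (W (1 ℕ.+ N)) S′ P′
      (trans (∙-rotate (W (1 ℕ.+ N)) S′ P′) (trans (cong (P′ ∙_) ⨯-S′) P′∙W)))

  open SequenceFrieze extend extend-⨯

  -- As `cycle (3 + n)` is `W (1 + n)`, the shift by `3 + k` turns the columns `c` and `c + 1` of
  -- `a` into the columns 0 and 1.
  w : Array
  w r e = entry r (e + + (3 ℕ.+ k))

  extend∙extend₃ : ∀ n → extend n ∙ extend (n + + 3) ≡ 1ℤ
  extend∙extend₃ n = begin
    extend n ∙ extend (n + + 3)     ≡⟨ E∙E₃-constant n ⟩
    extend (+ 0) ∙ extend (+ 3)     ≡⟨ E∙E₃-constant (+ 3) ⟨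
    -- The constant is evaluated at indices 3 and 6, which lie in the part of the cycle taken from
    -- `W`.
    extend (+ 3) ∙ extend (+ 6)     ≡⟨ cong₂ _∙_ (extend-+ {3} (ℕ.m≤m+n 4 _)) (extend-+ {6} (ℕ.m≤m+n 7 _)) ⟩
    W 1 ∙ W 4                       ≡⟨ W∙W₃ 1 ⟩
    1ℤ                              ∎

  w-closed : IsClosed2Frieze k w
  w-closed = record
    { top    = λ e → trans (cong (λ n → extend n ∙ extend (e + + (3 ℕ.+ k) + + 3)) (+-identityʳ (e + + (3 ℕ.+ k))))
                           (extend∙extend₃ (e + + (3 ℕ.+ k)))
    ; bottom = bottom
    ; local  = λ p _ e → trans (entry-local p (e + + (3 ℕ.+ k)))
        (cong₂ (λ i j → entry (suc p) i * entry (suc p) j - w p e * w (2 ℕ.+ p) e)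
               (shift e (+ (3 ℕ.+ k)) -1ℤ) (shift e (+ (3 ℕ.+ k)) 1ℤ))
    }
    where
    shift : ∀ e n d → e + n + d ≡ e + d + n
    shift = solve-∀
    -- In row `suc k` the two indices are three short of a full period apart, so the product is
    -- again one of terms at distance 3.
    bottom : ∀ e → w (suc k) e ≡ 1ℤ
    bottom e = begin
      extend s ∙ extend t           ≡⟨ ∙-comm (extend s) (extend t) ⟩
      extend t ∙ extend s           ≡⟨ cong (extend t ∙_) (extend-periodic s) ⟨
      extend t ∙ extend (s + + (5 ℕ.+ N))
                                    ≡⟨ cong (λ n → extend t ∙ extend n) index ⟩
      extend t ∙ extend (t + + 3)   ≡⟨ extend∙extend₃ t ⟩
      1ℤ                            ∎
      where
      s = e + + (3 ℕ.+ k) - + suc k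
      t = e + + (3 ℕ.+ k) + + (4 ℕ.+ k)
      index′ : ∀ e k → e + (+ 3 + k) - (1ℤ + k) + (+ 8 + k * + 2) ≡ e + (+ 3 + k) + (+ 4 + k) + + 3
      index′ = solve-∀
      index : s + + (5 ℕ.+ N) ≡ t + + 3
      index = trans (cong (λ n → s + (+ 8 + n)) (pos-* k 2)) (index′ e (+ k))

  -- For these rows and columns both indices lie between 3 and `4 + N`, where the cycle consists of
  -- the original vectors `W`. The upper bound is attained at `e = 1`, `r = k`.
  w-columns : ∀ r → r ℕ.≤ k → ∀ e → e ℕ.≤ 1 → w r (+ e) ≡ a r (c + + e)
  w-columns r r≤k e e≤1 = begin
    extend (+ (e ℕ.+ (3 ℕ.+ k)) - + r) ∙ extend (+ (e ℕ.+ (3 ℕ.+ k) ℕ.+ (3 ℕ.+ r)))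
      ≡⟨ cong₂ (λ i j → extend i ∙ extend j) index₁ (cong +_ (index₂ e k r)) ⟩
    extend (+ (3 ℕ.+ (e ℕ.+ d))) ∙ extend (+ (6 ℕ.+ (e ℕ.+ (k ℕ.+ r))))
      ≡⟨ cong₂ _∙_ (extend-+ bound₁) (extend-+ bound₂) ⟩
    W (1 ℕ.+ (e ℕ.+ d)) ∙ W (4 ℕ.+ (e ℕ.+ (k ℕ.+ r)))
      ≡⟨ entry-at _ _ (ℕ.≤-trans r≤k (ℕ.m≤n⇒m≤1+n k≤m)) column far-≡ ⟨
    a r (c + + e)
      ∎
    where
    d = k ℕ.∸ r
    k≡r+d : k ≡ r ℕ.+ d
    k≡r+d = sym (ℕ.m+[n∸m]≡n r≤k)
    index₁ : + (e ℕ.+ (3 ℕ.+ k)) - + r ≡ + (3 ℕ.+ (e ℕ.+ d))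
    index₁ = trans (cong (λ n → + (e ℕ.+ (3 ℕ.+ n)) - + r) k≡r+d) (lemma (+ e) (+ r) (+ d))
      where
      lemma : ∀ e r d → e + (+ 3 + (r + d)) - r ≡ + 3 + (e + d)
      lemma = solve-∀
    index₂ : ∀ e k r → e ℕ.+ (3 ℕ.+ k) ℕ.+ (3 ℕ.+ r) ≡ 6 ℕ.+ (e ℕ.+ (k ℕ.+ r))
    index₂ = ℕ.solve-∀
    bound : ∀ {n} → n ℕ.≤ k ℕ.* 2 → e ℕ.+ n ℕ.< 2 ℕ.+ k ℕ.* 2
    bound n≤ = s≤s (ℕ.+-mono-≤ e≤1 n≤)
    k*2 : ∀ k → k ℕ.+ k ≡ k ℕ.* 2
    k*2 = ℕ.solve-∀
    bound₂ : 6 ℕ.+ (e ℕ.+ (k ℕ.+ r)) ℕ.< 5 ℕ.+ N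
    bound₂ = ℕ.+-monoʳ-< 6 (bound (ℕ.≤-trans (ℕ.+-monoʳ-≤ k r≤k) (ℕ.≤-reflexive (k*2 k))))
    bound₁ : 3 ℕ.+ (e ℕ.+ d) ℕ.< 5 ℕ.+ N
    bound₁ = ℕ.≤-<-trans (ℕ.+-mono-≤ {3} {6} (ℕ.m≤m+n 3 3)
               (ℕ.+-monoʳ-≤ e (ℕ.≤-trans (ℕ.m∸n≤m k r) (ℕ.m≤m+n k r)))) bound₂
    column : c + + e ≡ c - + (2 ℕ.+ k) + + (1 ℕ.+ r ℕ.+ (1 ℕ.+ (e ℕ.+ d)))
    column = trans (lemma c (+ e) (+ r) (+ d))
      (cong (λ n → c - + (2 ℕ.+ n) + + (1 ℕ.+ r ℕ.+ (1 ℕ.+ (e ℕ.+ d)))) (sym k≡r+d))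
      where
      lemma : ∀ c e r d → c + e ≡ c - (+ 2 + (r + d)) + (1ℤ + r + (1ℤ + (e + d)))
      lemma = solve-∀
    far-≡ : 4 ℕ.+ (e ℕ.+ (k ℕ.+ r)) ≡ far r (1 ℕ.+ (e ℕ.+ d))
    far-≡ = trans (cong (λ n → 4 ℕ.+ (e ℕ.+ (n ℕ.+ r))) k≡r+d) (lemma e r d)
      where
      lemma : ∀ e r d → 4 ℕ.+ (e ℕ.+ (r ℕ.+ d ℕ.+ r)) ≡ 3 ℕ.+ (r ℕ.* 2 ℕ.+ (1 ℕ.+ (e ℕ.+ d)))
      lemma = ℕ.solve-∀

  w-integral : IsIntegralClosed2Frieze k w
  w-integral = record
    { isClosed2Frieze = w-closed
    ; positive        = positive-columns w-closed (column 0 z≤n) (column 1 ℕ.≤-refl)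
    }
    where
    column : ∀ e → e ℕ.≤ 1 → ∀ r → r ℕ.≤ k → 0ℤ < w r (+ e)
    column e e≤1 r r≤k = subst (0ℤ <_) (sym (w-columns r r≤k e e≤1))
      (IsIntegralClosed2Frieze.positive int r (ℕ.≤-trans r≤k (ℕ.m≤n⇒m≤1+n k≤m)) _)

theorem3 : ∀ (m : ℕ) (a : Array) → IsIntegralClosed2Frieze m a →
           ∀ (k : ℕ) → 1 ℕ.≤ k → k ℕ.≤ m → ∀ (c : ℤ) →
           let x = a k c
               y = a k (c + 1ℤ)
               u = a (suc k) c
               v = a (suc k) (c + 1ℤ)
           in (∃ λ (w : Array) → IsIntegralClosed2Frieze k w ×
                 (∀ (r : ℕ) → r ℕ.≤ k → ∀ (ε : Fin 2) →
                   w r (+ toℕ ε) ≡ a r (c + + toℕ ε)))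
              ⇔ (u ≡ 1ℤ mod y × v ≡ 1ℤ mod x)
theorem3 m a int k _ k≤m c = mk⇔ congruences cut
  where
  congruences : (∃ λ w → IsIntegralClosed2Frieze k w ×
                   (∀ r → r ℕ.≤ k → ∀ (ε : Fin 2) → w r (+ toℕ ε) ≡ a r (c + + toℕ ε))) →
                a (suc k) c ≡ 1ℤ mod a k (c + 1ℤ) × a (suc k) (c + 1ℤ) ≡ 1ℤ mod a k c
  congruences (w , int-w , eq) = subst₂ (λ i j → a (suc k) i ≡ 1ℤ mod a k j) c+1-1 c+1-0 left
                               , subst (λ i → a (suc k) (c + 1ℤ) ≡ 1ℤ mod a k i) (+-identityʳ c) right
    where
    c+1-1 : c + 1ℤ - 1ℤ ≡ c
    c+1-1 = trans (+-assoc c 1ℤ -1ℤ) (+-identityʳ c)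
    c+1-0 : c + 1ℤ - 0ℤ ≡ c + 1ℤ
    c+1-0 = +-identityʳ (c + 1ℤ)
    bottom = IsClosed2Frieze.bottom (IsIntegralClosed2Frieze.isClosed2Frieze int-w)
    -- Read leftwards from column `c + 1`, the modulus `y` stands in the first column and `u` in the
    -- second; read rightwards from `c`, the same holds for `x` and `v`.
    left = Comparison.congruence (leftHalf k≤m int (c + 1ℤ)) (leftHalf ℕ.≤-refl int-w 1ℤ)
      (λ r r≤k → trans (cong (a r) c+1-0) (sym (eq r r≤k (suc zero))))
      (λ r r≤k → trans (cong (a r) (trans c+1-1 (sym (+-identityʳ c)))) (sym (eq r r≤k zero)))
      (bottom _)
    right = Comparison.congruence (rightHalf k≤m int c) (rightHalf ℕ.≤-refl int-w 0ℤ)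
      (λ r r≤k → sym (eq r r≤k zero))
      (λ r r≤k → sym (eq r r≤k (suc zero)))
      (bottom _)
  cut : a (suc k) c ≡ 1ℤ mod a k (c + 1ℤ) × a (suc k) (c + 1ℤ) ≡ 1ℤ mod a k c → _
  cut (u≡1 , v≡1) = w , w-integral , λ r r≤k → λ
    { zero → w-columns r r≤k 0 z≤n ; (suc zero) → w-columns r r≤k 1 ℕ.≤-refl }
    where open Cut int k≤m c u≡1 v≡1
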